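{- Let $K$ be a finite simplicial complex, let $f:K\rightarrow\mathbb{R}$ be a combinatorial Morse function over $K$, and let $h_f:K\rightarrow\mathbb{Z}_{\geq 0}$ be the normalization of $f$. Then for every $\sigma\in K$, $h_f(\sigma)\leq g(\sigma)$ whenever $g:K\rightarrow\mathbb{Z}_{\geq 0}$ is a combinatorial Morse function equivalent to $f$.
   Context: $K$ is identified with its set of (non-empty) simplices. Write $\sigma\prec\tau$ (or $\tau\succ\sigma$) if $\sigma$ is an immediate face of $\tau$ in $K$, i.e. $\sigma$ is a face of $\tau$ and $\dim(\sigma)=\dim(\tau)-1$. A discrete vector field over $K$ is a map $W:K\rightarrow K\cup\{0\}$ such that (W1) if $W(\sigma)\neq 0$ then $\sigma\prec W(\sigma)$; (W2) if $W(\sigma)=W(\sigma')\neq 0$ then $\sigma=\sigma'$; (W3) $W^2=0$, i.e. if $W(\sigma)\neq 0$ then $W(W(\sigma))=0$. A combinatorial Morse function over $K$ is a map $f:K\rightarrow\mathbb{R}$ such that for every $\sigma\in K$: (M1) $|\{\eta\prec\sigma : f(\eta)\geq f(\sigma)\}|\leq 1$ and (M2) $|\{\tau\succ\sigma : f(\tau)\leq f(\sigma)\}|\leq 1$. Its gradient vector field $V_f$ is the discrete vector field given by $V_f(\sigma)=\tau$ if $\tau\succ\sigma$ and $f(\sigma)\geq f(\tau)$, and $V_f(\sigma)=0$ if there is no such $\tau$. Two combinatorial Morse functions $f,g$ over $K$ are equivalent if $V_f=V_g$ (equivalently, $f(\sigma)<f(\tau)$ if and only if $g(\sigma)<g(\tau)$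 for every $\sigma\prec\tau$). A path of index $k$ relative to a discrete vector field $W$ is a sequence of $k$-simplices $\sigma_0,\ldots,\sigma_r\in W^{ -1}(K)$ such that $\sigma_i\neq\sigma_{i+1}$ and $\sigma_{i+1}\prec W(\sigma_i)$ for all $0\leq i\leq r-1$; it is closed if $\sigma_0=\sigma_r$ and non-stationary if $r>0$. $W$ is admissible if it has no non-stationary closed paths; by a theorem of Forman, this holds if and only if $W$ is the gradient vector field of a combinatorial Morse function. For an admissible discrete vector field $W$, let $\lessdot$ be the relation on $K$ obtained as the transitive closure of the following atomic relations: (1) $\sigma\lessdot\tau$ if $\sigma\prec\tau$; and (2) $\sigma\gtrdot\tau$ (i.e. $\tau\lessdot\sigma$) if $\tau=W(\sigma)$. Write $\sigma\mathbin{\dot{\sim}}\tau$ whenever $\sigma\lessdot\tau$ and $\sigma\gtrdot\tau$. The height function $h:K\rightarrow\mathbb{Z}_{\geq 0}$ associated to $W$ is defined by letting $h(\sigma)$ be the maximum $n\in\mathbb{Z}_{\geq 0}$ for which there exists a chain $\sigma=\sigma_n\gtrdot\sigma_{n-1}\gtrdot\cdots\gtrdot\sigma_0$ in $K$ such that $\sigma_i\mathbin{\dot{\sim}}\sigma_{i+1}$ does not hold for any $0\leq i\leq n-1$. The normalization $h_f$ of a combinatorial Morse function $f$ is the height function associated to $V_f$. -}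

module Defs where

open import Level using (0ℓ)
open import Data.Bool using (Bool; T)
open import Data.Nat using (ℕ; zero; suc; pred)
import Data.Nat as ℕ
open import Data.Integer using (+_)
open import Data.Rational using (ℚ; _<_; 1ℚ; -_; _+_; _/_)
import Data.Rational.Properties as ℚ
open import Data.Fin.Subset using (Subset; Nonempty; ∣_∣; _⊆_)
open import Data.Maybe using (Maybe; just; nothing)
open import Data.Product using (∃; _×_; _,_)
open import Data.Sum using (_⊎_; inj₁; inj₂)
open import Function using (_⇔_; mk⇔; _∘_)
open import Relation.Nullary using (¬_)
open import Relation.Unary using (Pred)
open import Relation.Binary using (Rel; tri<; tri≈; tri>)
open import Relation.Binary.PropositionalEquality using (_≡_; refl; subst)
open import Relation.Binary.Construct.Closure.Transitive using (TransClosure)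

-- Real numbers as two-sided Dedekind cuts of ℚ.

record ℝ : Set₁ where
  field
    Lower Upper     : Pred ℚ 0ℓ
    lower-inhabited : ∃ Lower
    upper-inhabited : ∃ Upper
    lower-rounded   : ∀ q → Lower q ⇔ (∃ λ r → q < r × Lower r)
    upper-rounded   : ∀ q → Upper q ⇔ (∃ λ r → r < q × Upper r)
    disjoint        : ∀ q → ¬ (Lower q × Upper q)
    located         : ∀ {q r} → q < r → Lower q ⊎ Upper r

infix 4 _≤ᵣ_

_≤ᵣ_ : Rel ℝ 0ℓ
x ≤ᵣ y = ∀ q → ℝ.Lower x q → ℝ.Lower y q

private
  p-1<p : ∀ p → p + - 1ℚ < p
  p-1<p p = subst (p + - 1ℚ <_) (ℚ.+-identityʳ p) (ℚ.+-monoʳ-< p (ℚ.negative⁻¹ (- 1ℚ)))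

  p<p+1 : ∀ p → p < p + 1ℚ
  p<p+1 p = subst (_< p + 1ℚ) (ℚ.+-identityʳ p) (ℚ.+-monoʳ-< p (ℚ.positive⁻¹ 1ℚ))

fromℚ : ℚ → ℝ
fromℚ p = record
  { Lower           = _< p
  ; Upper           = p <_
  ; lower-inhabited = p + - 1ℚ , p-1<p p
  ; upper-inhabited = p + 1ℚ , p<p+1 p
  ; lower-rounded   = λ q → mk⇔ ℚ.<-dense (λ (r , q<r , r<p) → ℚ.<-trans q<r r<p)
  ; upper-rounded   = λ q → mk⇔ (λ p<q → let r , p<r , r<q = ℚ.<-dense p<q in r , r<q , p<r)
                                (λ (r , r<q , p<r) → ℚ.<-trans p<r r<q)
  ; disjoint        = λ q (q<p , p<q) → ℚ.<-asym q<p p<q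
  ; located         = loc
  }
  where
  loc : ∀ {q r} → q < r → q < p ⊎ p < r
  loc {q} q<r with ℚ.<-cmp q p
  ... | tri< q<p _ _    = inj₁ q<p
  ... | tri≈ _ refl _   = inj₂ q<r
  ... | tri> _ _ p<q    = inj₂ (ℚ.<-trans p<q q<r)

fromℕ : ℕ → ℝ
fromℕ n = fromℚ (+ n / 1)

-- An abstract complex whose vertices are among the elements of Fin n.

record FiniteSimplicialComplex : Set where
  field
    n           : ℕ
    isSimplex   : Subset n → Bool
    nonempty    : ∀ {s} → T (isSimplex s) → Nonempty s
    down-closed : ∀ {s t} → T (isSimplex t) → s ⊆ t → Nonempty s → T (isSimplex s)

AtMostOne : ∀ {a p} {A : Set a} → Pred A p → Set _
AtMostOne P = ∀ {x y} → P x → P y → x ≡ y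

module _ (K : FiniteSimplicialComplex) where
  open FiniteSimplicialComplex K

  -- Two simplices with the same vertices are propositionally equal, because
  -- T b has at most one element.
  record Simplex : Set where
    constructor simplex
    field
      vertices : Subset n
      simplex∈ : T (isSimplex vertices)

module _ {K : FiniteSimplicialComplex} where
  open Simplex

  dim : Simplex K → ℕ
  dim σ = pred ∣ vertices σ ∣

  infix 4 _≺_

  _≺_ : Rel (Simplex K) 0ℓ
  σ ≺ τ = vertices σ ⊆ vertices τ × suc (dim σ) ≡ dim τ

  record IsMorse (f : Simplex K → ℝ) : Set where
    field
      M1 : ∀ σ → AtMostOne (λ η → η ≺ σ × f σ ≤ᵣ f η)
      M2 : ∀ σ → AtMostOne (λ τ → σ ≺ τ × f τ ≤ᵣ f σ)

-- nothing plays the role of 0.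

record DiscreteVectorField (K : FiniteSimplicialComplex) : Set where
  field
    W  : Simplex K → Maybe (Simplex K)
    W1 : ∀ {σ τ} → W σ ≡ just τ → σ ≺ τ
    W2 : ∀ {σ σ′ τ} → W σ ≡ just τ → W σ′ ≡ just τ → σ ≡ σ′
    W3 : ∀ {σ τ} → W σ ≡ just τ → W τ ≡ nothing

module _ {K : FiniteSimplicialComplex} where
  open DiscreteVectorField

  -- The order of ℝ is not decidable, so V_f is specified by its graph, which
  -- determines it: V σ is nothing exactly when no such τ exists.
  IsGradient : (Simplex K → ℝ) → DiscreteVectorField K → Set
  IsGradient f V = ∀ σ τ → W V σ ≡ just τ ⇔ (σ ≺ τ × f τ ≤ᵣ f σ)

  -- V_f = V_g.
  Equivalent : (f g : Simplex K → ℝ) → Set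
  Equivalent f g = ∃ λ V → IsGradient f V × IsGradient g V

  module _ (V : DiscreteVectorField K) where

    data Atomic : Rel (Simplex K) 0ℓ where
      face : ∀ {σ τ} → σ ≺ τ → Atomic σ τ
      flow : ∀ {σ τ} → W V σ ≡ just τ → Atomic τ σ

    infix 4 _⋖_ _∼_

    _⋖_ : Rel (Simplex K) 0ℓ
    _⋖_ = TransClosure Atomic

    _∼_ : Rel (Simplex K) 0ℓ
    σ ∼ τ = σ ⋖ τ × τ ⋖ σ

    -- Chain σ n : chains σ = σₙ ⋗ ⋯ ⋗ σ₀ with no two consecutive terms related by ∼.
    data Chain : Simplex K → ℕ → Set where
      end  : ∀ {σ} → Chain σ zero
      step : ∀ {σ τ n} → τ ⋖ σ → ¬ (τ ∼ σ) → Chain τ n → Chain σ (suc n)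

    IsHeight : (Simplex K → ℕ) → Set
    IsHeight h = ∀ σ → Chain σ (h σ) × (∀ m → Chain σ m → m ℕ.≤ h σ)

  IsNormalization : (Simplex K → ℝ) → (Simplex K → ℕ) → Set
  IsNormalization f h = ∃ λ V → IsGradient f V × IsHeight V h

{-# OPTIONS --safe #-}
module Submission where

-- Let V be the gradient field of f, which is also that of g. Along a chain of
-- the height function g itself need not decrease: if V sends both σ to τ and
-- τ′ to μ, where σ ≺ τ ≺ μ and σ ≺ τ′ ≺ μ, then σ ⋖ μ, and yet g σ may exceed
-- g μ. The remedy is to replace g by its minimum on each pair matched by V,
--
--   lowered σ = g τ  if V σ = τ,     lowered σ = g σ  if V σ = 0.
--
-- The two members of a matched pair have equal lowered values, and lowered is
-- strictly increasing along every face relation σ ≺ τ not matched by V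
-- (lowered-<). When V τ = 0 this is immediate. When V τ = μ, there is a second
-- simplex τ′ ≠ τ strictly between σ and μ (diamond); then
-- lowered σ ≤ g τ′ < g μ = lowered τ, where the strict inequality holds because
-- V matches τ, hence not τ′, with μ. So lowered never decreases along a path of
-- atomic relations; either it increases somewhere, or each relation of the path
-- joins a matched pair and the path can be reversed (⋖⇒lowered). Hence lowered
-- drops at every step of a chain from σ, whose length is therefore at most
-- lowered σ ≤ g σ.

open import Defs
open import Data.Nat using (ℕ; _≤_; _<_; suc; pred; z≤n)
import Data.Nat.Properties as ℕ
import Data.Nat.Coprimality as Coprimality
open import Data.Integer using (+_; +≤+)
import Data.Integer.Properties as ℤ
import Data.Rational as ℚ
import Data.Rational.Properties as ℚ
open import Data.Bool.Properties using (T-irrelevant) renaming (_≟_ to _≟ᵇ_)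
open import Data.Fin using (zero; suc)
open import Data.Fin.Properties using (any?)
open import Data.Fin.Subset using (Subset; Nonempty; _∈_; _∉_; _⊆_; _∪_; ⁅_⁆; ∣_∣; inside; outside)
open import Data.Fin.Subset.Properties
  using (_∈?_; ∪-identityʳ; p⊆p∪q; q⊆p∪q; x∈⁅x⁆; x∈⁅y⁆⇒x≡y; x∈p∪q⁻; p⊆q⇒∣p∣≤∣q∣; ∣⁅x⁆∣≡1)
open import Data.Maybe using (just; nothing; maybe′)
import Data.Maybe.Properties as Maybe
open import Data.Product using (∃; _×_; _,_; proj₁; proj₂)
open import Data.Sum using (_⊎_; inj₁; inj₂)
open import Data.Vec using (_∷_; here; there)
import Data.Vec.Properties as Vec
open import Function using (_∘_; Equivalence)
open import Function.Construct.Composition using (_⇔-∘_)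
open import Function.Construct.Symmetry using (⇔-sym)
open import Relation.Nullary using (yes; no; ¬?; _×-dec_; contradiction; decidable-stable)
open import Relation.Nullary.Decidable using (map′)
open import Relation.Binary using (DecidableEquality)
open import Relation.Binary.PropositionalEquality
  using (_≡_; _≢_; refl; sym; trans; cong; subst; subst₂)
open import Relation.Binary.Construct.Closure.Transitive using ([_]; _∷_; _∷ʳ_)

n/1≡mkℚ : ∀ n → + n ℚ./ 1 ≡ ℚ.mkℚ (+ n) 0 (Coprimality.sym (Coprimality.1-coprimeTo n))
n/1≡mkℚ n = ℚ.normalize-coprime (Coprimality.sym (Coprimality.1-coprimeTo n))

/1-mono-≤ : ∀ {m n} → m ≤ n → + m ℚ./ 1 ℚ.≤ + n ℚ./ 1
/1-mono-≤ {m} {n} m≤n = subst₂ ℚ._≤_ (sym (n/1≡mkℚ m)) (sym (n/1≡mkℚ n))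
  (ℚ.*≤* (ℤ.*-monoʳ-≤-nonNeg (+ 1) (+≤+ m≤n)))

/1-cancel-≤ : ∀ {m n} → + m ℚ./ 1 ℚ.≤ + n ℚ./ 1 → m ≤ n
/1-cancel-≤ {m} {n} m≤n with subst₂ ℚ._≤_ (n/1≡mkℚ m) (n/1≡mkℚ n) m≤n
... | ℚ.*≤* m*1≤n*1 = ℤ.drop‿+≤+ (ℤ.*-cancelʳ-≤-pos (+ m) (+ n) (+ 1) m*1≤n*1)

fromℕ-mono : ∀ {m n} → m ≤ n → fromℕ m ≤ᵣ fromℕ n
fromℕ-mono m≤n q q<m = ℚ.<-≤-trans q<m (/1-mono-≤ m≤n)

-- If n / 1 were below m / 1, it would lie in the lower cut of m, hence in
-- that of n, and be below itself.
fromℕ-cancel : ∀ {m n} → fromℕ m ≤ᵣ fromℕ n → m ≤ n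
fromℕ-cancel {m} {n} m≤n =
  /1-cancel-≤ (ℚ.≮⇒≥ (λ n<m → ℚ.<-irrefl refl (m≤n (+ n ℚ./ 1) n<m)))

∣p∪⁅x⁆∣ : ∀ {n} (p : Subset n) {x} → x ∉ p → ∣ p ∪ ⁅ x ⁆ ∣ ≡ suc ∣ p ∣
∣p∪⁅x⁆∣ (inside  ∷ p) {zero}  x∉p = contradiction here x∉p
∣p∪⁅x⁆∣ (outside ∷ p) {zero}  x∉p = cong (suc ∘ ∣_∣) (∪-identityʳ p)
∣p∪⁅x⁆∣ (inside  ∷ p) {suc x} x∉p = cong suc (∣p∪⁅x⁆∣ p (x∉p ∘ there))
∣p∪⁅x⁆∣ (outside ∷ p) {suc x} x∉p = ∣p∪⁅x⁆∣ p (x∉p ∘ there)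

Nonempty⇒0<∣p∣ : ∀ {n} {p : Subset n} → Nonempty p → 0 < ∣ p ∣
Nonempty⇒0<∣p∣ {p = p} (x , x∈p) = subst (_≤ ∣ p ∣) (∣⁅x⁆∣≡1 x)
  (p⊆q⇒∣p∣≤∣q∣ (λ y∈⁅x⁆ → subst (_∈ p) (sym (x∈⁅y⁆⇒x≡y x y∈⁅x⁆)) x∈p))

∣p∣<∣q∣⇒∃x∈q∖p : ∀ {n} {p q : Subset n} → ∣ p ∣ < ∣ q ∣ → ∃ λ x → x ∈ q × x ∉ p
∣p∣<∣q∣⇒∃x∈q∖p {p = p} {q} ∣p∣<∣q∣ with any? (λ x → (x ∈? q) ×-dec ¬? (x ∈? p))
... | yes ∃x = ∃x
... | no ∄x  = contradiction (p⊆q⇒∣p∣≤∣q∣ q⊆p) (ℕ.<⇒≱ ∣p∣<∣q∣)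
  where
  q⊆p : q ⊆ p
  q⊆p {x} x∈q = decidable-stable (x ∈? p) (λ x∉p → ∄x (x , x∈q , x∉p))

module _ {K : FiniteSimplicialComplex} where
  open FiniteSimplicialComplex K
  open Simplex

  simplex-≡ : {σ τ : Simplex K} → vertices σ ≡ vertices τ → σ ≡ τ
  simplex-≡ {simplex v s} {simplex .v t} refl = cong (simplex v) (T-irrelevant s t)

  _≟_ : DecidableEquality (Simplex K)
  σ ≟ τ = map′ simplex-≡ (cong vertices) (Vec.≡-dec _≟ᵇ_ (vertices σ) (vertices τ))

  ∣vertices∣≡1+dim : (σ : Simplex K) → ∣ vertices σ ∣ ≡ suc (dim σ)
  ∣vertices∣≡1+dim σ with ∣ vertices σ ∣ | Nonempty⇒0<∣p∣ (nonempty (simplex∈ σ))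
  ... | suc _ | _ = refl

  ≺⇒∣vertices∣< : {σ τ : Simplex K} → σ ≺ τ → ∣ vertices σ ∣ < ∣ vertices τ ∣
  ≺⇒∣vertices∣< {σ} {τ} (_ , dimτ)
    rewrite ∣vertices∣≡1+dim σ | ∣vertices∣≡1+dim τ | dimτ = ℕ.≤-refl

  -- The second simplex is spanned by ρ and a vertex of μ outside σ.
  diamond : {ρ σ μ : Simplex K} → ρ ≺ σ → σ ≺ μ → ∃ λ σ′ → σ′ ≢ σ × ρ ≺ σ′ × σ′ ≺ μ
  diamond {ρ} {σ} {μ} (ρ⊆σ , dimσ) σ≺μ@(σ⊆μ , dimμ)
    with x , x∈μ , x∉σ ← ∣p∣<∣q∣⇒∃x∈q∖p (≺⇒∣vertices∣< {σ} {μ} σ≺μ)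
    = σ′ , (λ σ′≡σ → x∉σ (subst (λ υ → x ∈ vertices υ) σ′≡σ x∈σ′)) , (p⊆p∪q ⁅ x ⁆ , sym dimσ′)
         , (σ′⊆μ , trans (cong suc (trans dimσ′ dimσ)) dimμ)
    where
    x∈σ′ : x ∈ vertices ρ ∪ ⁅ x ⁆
    x∈σ′ = q⊆p∪q (vertices ρ) ⁅ x ⁆ (x∈⁅x⁆ x)

    σ′⊆μ : vertices ρ ∪ ⁅ x ⁆ ⊆ vertices μ
    σ′⊆μ y∈σ′ with x∈p∪q⁻ (vertices ρ) ⁅ x ⁆ y∈σ′
    ... | inj₁ y∈ρ   = σ⊆μ (ρ⊆σ y∈ρ)
    ... | inj₂ y∈⁅x⁆ = subst (_∈ vertices μ) (sym (x∈⁅y⁆⇒x≡y x y∈⁅x⁆)) x∈μ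

    σ′ : Simplex K
    σ′ = simplex (vertices ρ ∪ ⁅ x ⁆) (down-closed (simplex∈ μ) σ′⊆μ (x , x∈σ′))

    dimσ′ : dim σ′ ≡ suc (dim ρ)
    dimσ′ = trans (cong pred (∣p∪⁅x⁆∣ (vertices ρ) (x∉σ ∘ ρ⊆σ))) (∣vertices∣≡1+dim ρ)

module _ {K : FiniteSimplicialComplex} (V : DiscreteVectorField K)
         (g : Simplex K → ℕ) (grad : IsGradient (fromℕ ∘ g) V) where
  open DiscreteVectorField V

  matched⇒≥ : ∀ {σ τ} → W σ ≡ just τ → g τ ≤ g σ
  matched⇒≥ Wσ≡τ = fromℕ-cancel (proj₂ (Equivalence.to (grad _ _) Wσ≡τ))

  unmatched⇒< : ∀ {σ τ} → σ ≺ τ → W σ ≢ just τ → g σ < g τ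
  unmatched⇒< σ≺τ Wσ≢τ =
    ℕ.≰⇒> (λ gτ≤gσ → Wσ≢τ (Equivalence.from (grad _ _) (σ≺τ , fromℕ-mono gτ≤gσ)))

  -- The minimum of g on the pair matched by V that contains σ, or g σ if σ is
  -- critical.
  lowered : Simplex K → ℕ
  lowered σ = maybe′ g (g σ) (W σ)

  lowered-≤ : ∀ σ → lowered σ ≤ g σ
  lowered-≤ σ with W σ in Wσ≡
  ... | nothing = ℕ.≤-refl
  ... | just _  = matched⇒≥ Wσ≡

  matched⇒lowered≡ : ∀ {σ τ} → W σ ≡ just τ → lowered τ ≡ lowered σ
  matched⇒lowered≡ Wσ≡τ rewrite W3 Wσ≡τ | Wσ≡τ = refl

  ≺⇒lowered≤ : ∀ {σ τ} → σ ≺ τ → lowered σ ≤ g τ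
  ≺⇒lowered≤ {σ} {τ} σ≺τ with Maybe.≡-dec _≟_ (W σ) (just τ)
  ... | yes Wσ≡τ rewrite Wσ≡τ = ℕ.≤-refl
  ... | no  Wσ≢τ = ℕ.≤-trans (lowered-≤ σ) (ℕ.<⇒≤ (unmatched⇒< σ≺τ Wσ≢τ))

  lowered-< : ∀ {σ τ} → σ ≺ τ → W σ ≢ just τ → lowered σ < lowered τ
  lowered-< {σ} {τ} σ≺τ Wσ≢τ with W τ in Wτ≡
  ... | nothing = ℕ.≤-<-trans (lowered-≤ σ) (unmatched⇒< σ≺τ Wσ≢τ)
  ... | just μ  with τ′ , τ′≢τ , σ≺τ′ , τ′≺μ ← diamond {ρ = σ} {τ} {μ} σ≺τ (W1 Wτ≡)
    = ℕ.≤-<-trans (≺⇒lowered≤ σ≺τ′) (unmatched⇒< τ′≺μ (λ Wτ′≡μ → τ′≢τ (W2 Wτ′≡μ Wτ≡)))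

  -- Equality occurs exactly inside a matched pair, where the two kinds of atomic
  -- relation are reverse to each other.
  Atomic⇒lowered : ∀ {σ τ} → Atomic V σ τ →
    lowered σ < lowered τ ⊎ (lowered σ ≡ lowered τ × Atomic V τ σ)
  Atomic⇒lowered {σ} {τ} (face σ≺τ) with Maybe.≡-dec _≟_ (W σ) (just τ)
  ... | yes Wσ≡τ = inj₂ (sym (matched⇒lowered≡ Wσ≡τ) , flow Wσ≡τ)
  ... | no  Wσ≢τ = inj₁ (lowered-< σ≺τ Wσ≢τ)
  Atomic⇒lowered (flow Wτ≡σ) = inj₂ (matched⇒lowered≡ Wτ≡σ , face (W1 Wτ≡σ))

  ⋖⇒lowered : ∀ {σ τ} → _⋖_ V σ τ →
    lowered σ < lowered τ ⊎ (lowered σ ≡ lowered τ × _⋖_ V τ σ)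
  ⋖⇒lowered [ a ] with Atomic⇒lowered a
  ... | inj₁ σ<τ         = inj₁ σ<τ
  ... | inj₂ (σ≡τ , a⁻¹) = inj₂ (σ≡τ , [ a⁻¹ ])
  ⋖⇒lowered (a ∷ p) with Atomic⇒lowered a | ⋖⇒lowered p
  ... | inj₁ σ<ρ         | inj₁ ρ<τ         = inj₁ (ℕ.<-trans σ<ρ ρ<τ)
  ... | inj₁ σ<ρ         | inj₂ (ρ≡τ , _)   = inj₁ (ℕ.<-≤-trans σ<ρ (ℕ.≤-reflexive ρ≡τ))
  ... | inj₂ (σ≡ρ , _)   | inj₁ ρ<τ         = inj₁ (ℕ.≤-<-trans (ℕ.≤-reflexive σ≡ρ) ρ<τ)
  ... | inj₂ (σ≡ρ , a⁻¹) | inj₂ (ρ≡τ , p⁻¹) = inj₂ (trans σ≡ρ ρ≡τ , p⁻¹ ∷ʳ a⁻¹)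

  chain-length≤lowered : ∀ {σ n} → Chain V σ n → n ≤ lowered σ
  chain-length≤lowered end = z≤n
  chain-length≤lowered (step τ⋖σ τ≁σ c) with ⋖⇒lowered τ⋖σ
  ... | inj₁ τ<σ       = ℕ.≤-<-trans (chain-length≤lowered c) τ<σ
  ... | inj₂ (_ , σ⋖τ) = contradiction (τ⋖σ , σ⋖τ) τ≁σ

proposition5 : (K : FiniteSimplicialComplex) (f : Simplex K → ℝ) → IsMorse f →
    (h : Simplex K → ℕ) → IsNormalization f h →
    (σ : Simplex K) (g : Simplex K → ℕ) → IsMorse (fromℕ ∘ g) → Equivalent f (fromℕ ∘ g) →
    h σ ≤ g σ
proposition5 K f _ h (V , f-grad-V , height) σ g _ (V′ , f-grad-V′ , g-grad-V′) =
  ℕ.≤-trans (chain-length≤lowered V g g-grad-V (proj₁ (height σ))) (lowered-≤ V g g-grad-V σ)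
  where
  -- V and V′ have the same graph, since both are gradients of f.
  g-grad-V : IsGradient (fromℕ ∘ g) V
  g-grad-V ρ τ = g-grad-V′ ρ τ ⇔-∘ (⇔-sym (f-grad-V′ ρ τ) ⇔-∘ f-grad-V ρ τ)
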